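{- Let $\mathbf d$ be a non-zero c.e. Turing degree. Then there exists a total function $f:\omega\to\omega$ of Turing degree $\mathbf d$ such that (the PR-degree of) $f$ is low for punctual isomorphism.
   Context: A punctual structure is a structure with domain $\omega$ whose operations and relations are uniformly primitive recursive. Two punctual structures are punctually isomorphic if there is an isomorphism $h$ between them such that both $h$ and $h^{ -1}$ are primitive recursive. For total functions $f,g:\omega\to\omega$, write $f\leq_{PR} g$ if there is a primitive recursive scheme $\Psi$ (a primitive recursive definition which may additionally use the oracle function as a basic function) with $\Psi^{g}=f$. Write $f\equiv_{PR}g$ if $f\leq_{PR}g$ and $g\leq_{PR}f$. The $\equiv_{PR}$-classes are the PR-degrees, ordered by $\leq_{PR}$. The join $f\oplus g$ is defined by $(f\oplus g)(2n)=f(n)$, $(f\oplus g)(2n+1)=g(n)$. A PR-degree $\mathbf a$ is low for punctual isomorphism if for all punctual structures $A\cong B$: whenever there is an isomorphism $h:A\to B$ with $h\oplus h^{ -1}\leq_{PR}\mathbf a$, then $A$ and $B$ are punctually isomorphic. -}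

module Defs where

open import Data.Bool using (Bool; true; false)
open import Data.Empty using (⊥)
open import Data.Fin using (Fin; toℕ)
open import Data.Nat using (ℕ; zero; suc; _+_; _*_; _<_)
open import Data.Nat.Properties using (+-suc)
open import Data.Product using (Σ; ∃-syntax; _×_)
open import Data.Unit using (⊤)
open import Data.Vec using (Vec; []; _∷_; lookup; map)
open import Function using (id; _∘_; _⇔_; _↔_; Inverse)
open import Relation.Binary.PropositionalEquality using (_≡_; refl)

-- Primitive recursive schemes.  Ω is the type of names of additional basic
-- unary functions: ⊥ for plain primitive recursion, ⊤ for one oracle.

data Scheme (Ω : Set) : ℕ → Set where
  zer  : Scheme Ω 0
  succ : Scheme Ω 1
  proj : ∀ {n} → Fin n → Scheme Ω n
  comp : ∀ {m n} → Scheme Ω m → Vec (Scheme Ω n) m → Scheme Ω n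
  prec : ∀ {n} → Scheme Ω n → Scheme Ω (2 + n) → Scheme Ω (1 + n)
  orac : Ω → Scheme Ω 1

module _ {Ω : Set} (φ : Ω → ℕ → ℕ) where

  mutual
    eval : ∀ {n} → Scheme Ω n → Vec ℕ n → ℕ
    eval zer        []       = 0
    eval succ       (x ∷ []) = suc x
    eval (proj i)   xs       = lookup xs i
    eval (comp s t) xs       = eval s (evals t xs)
    eval (prec s t) (x ∷ xs) = evalRec s t x xs
    eval (orac o)   (x ∷ []) = φ o x

    evals : ∀ {m n} → Vec (Scheme Ω n) m → Vec ℕ n → Vec ℕ m
    evals []       xs = []
    evals (s ∷ ss) xs = eval s xs ∷ evals ss xs

    evalRec : ∀ {n} → Scheme Ω n → Scheme Ω (2 + n) → ℕ → Vec ℕ n → ℕ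
    evalRec s t zero    xs = eval s xs
    evalRec s t (suc x) xs = eval t (x ∷ evalRec s t x xs ∷ xs)

noOracle : ⊥ → ℕ → ℕ
noOracle ()

oracle : (ℕ → ℕ) → ⊤ → ℕ → ℕ
oracle g _ = g

PrimRec₁ : (ℕ → ℕ) → Set
PrimRec₁ f = Σ (Scheme ⊥ 1) λ s → ∀ x → eval noOracle s (x ∷ []) ≡ f x

infix 4 _≤PR_ _≤T_ _≡T_

_≤PR_ : (ℕ → ℕ) → (ℕ → ℕ) → Set
f ≤PR g = Σ (Scheme ⊤ 1) λ Ψ → ∀ x → eval (oracle g) Ψ (x ∷ []) ≡ f x

infixr 6 _⊕_

_⊕_ : (ℕ → ℕ) → (ℕ → ℕ) → ℕ → ℕ
(f ⊕ g) zero          = f 0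
(f ⊕ g) (suc zero)    = g 0
(f ⊕ g) (suc (suc n)) = ((f ∘ suc) ⊕ (g ∘ suc)) n

⊕-even : ∀ f g n → (f ⊕ g) (2 * n) ≡ f n
⊕-even f g zero = refl
⊕-even f g (suc n) rewrite +-suc n (n + 0) = ⊕-even (f ∘ suc) (g ∘ suc) n

⊕-odd : ∀ f g n → (f ⊕ g) (1 + 2 * n) ≡ g n
⊕-odd f g zero = refl
⊕-odd f g (suc n) rewrite +-suc n (n + 0) = ⊕-odd (f ∘ suc) (g ∘ suc) n

-- Partial recursive functionals: the schemes above together with unbounded
-- minimisation, with a big-step semantics because evaluation may diverge.

data Program (Ω : Set) : ℕ → Set where
  zer  : Program Ω 0
  succ : Program Ω 1
  proj : ∀ {n} → Fin n → Program Ω n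
  comp : ∀ {m n} → Program Ω m → Vec (Program Ω n) m → Program Ω n
  prec : ∀ {n} → Program Ω n → Program Ω (2 + n) → Program Ω (1 + n)
  mini : ∀ {n} → Program Ω (1 + n) → Program Ω n
  orac : Ω → Program Ω 1

module _ {Ω : Set} (φ : Ω → ℕ → ℕ) where

  mutual
    data Eval : ∀ {n} → Program Ω n → Vec ℕ n → ℕ → Set where
      e-zer   : Eval zer [] 0
      e-succ  : ∀ {x} → Eval succ (x ∷ []) (suc x)
      e-proj  : ∀ {n} {i : Fin n} {xs} → Eval (proj i) xs (lookup xs i)
      e-comp  : ∀ {m n} {p : Program Ω m} {qs : Vec (Program Ω n) m} {xs ys z} →
                Evals qs xs ys → Eval p ys z → Eval (comp p qs) xs z
      e-prec₀ : ∀ {n} {p : Program Ω n} {q xs y} →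
                Eval p xs y → Eval (prec p q) (0 ∷ xs) y
      e-precₛ : ∀ {n} {p : Program Ω n} {q x xs y z} →
                Eval (prec p q) (x ∷ xs) y → Eval q (x ∷ y ∷ xs) z →
                Eval (prec p q) (suc x ∷ xs) z
      e-mini  : ∀ {n} {p : Program Ω (1 + n)} {xs y} →
                Eval p (y ∷ xs) 0 →
                (∀ z → z < y → ∃[ w ] Eval p (z ∷ xs) (suc w)) →
                Eval (mini p) xs y
      e-orac  : ∀ {o x} → Eval (orac o) (x ∷ []) (φ o x)

    data Evals {n} : ∀ {m} → Vec (Program Ω n) m → Vec ℕ n → Vec ℕ m → Set where
      []  : ∀ {xs} → Evals [] xs []
      _∷_ : ∀ {m p} {ps : Vec (Program Ω n) m} {xs y ys} →
            Eval p xs y → Evals ps xs ys → Evals (p ∷ ps) xs (y ∷ ys)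

Computable : (ℕ → ℕ) → Set
Computable f = Σ (Program ⊥ 1) λ p → ∀ x → Eval noOracle p (x ∷ []) (f x)

_≤T_ : (ℕ → ℕ) → (ℕ → ℕ) → Set
f ≤T g = Σ (Program ⊤ 1) λ p → ∀ x → Eval (oracle g) p (x ∷ []) (f x)

_≡T_ : (ℕ → ℕ) → (ℕ → ℕ) → Set
f ≡T g = f ≤T g × g ≤T f

-- Subsets of ω are Bool-valued; classically this is every subset.

bit : Bool → ℕ
bit false = 0
bit true  = 1

ComputablyEnumerable : (ℕ → Bool) → Set
ComputablyEnumerable W =
  Σ (Program ⊥ 1) λ p → ∀ x → (W x ≡ true) ⇔ (∃[ y ] Eval noOracle p (x ∷ []) y)

-- A Turing degree is given by any of its members.

HasCEDegree : (ℕ → ℕ) → Set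
HasCEDegree d = Σ (ℕ → Bool) λ W → ComputablyEnumerable W × (bit ∘ W) ≡T d

-- Cantor pairing, iterated to code tuples of a known length.

triangle : ℕ → ℕ
triangle zero    = 0
triangle (suc n) = suc n + triangle n

pair : ℕ → ℕ → ℕ
pair x y = triangle (x + y) + y

code : ∀ {n} → Vec ℕ n → ℕ
code []       = 0
code (x ∷ xs) = pair x (code xs)

-- A finite or countably infinite list of symbols, with primitive recursive
-- arities (no restriction when the list is finite).

data Size : Set where
  finite   : ℕ → Size
  infinite : Size

Index : Size → Set
Index (finite n) = Fin n
Index infinite   = ℕ

index : ∀ {k} → Index k → ℕ
index {finite n} = toℕ
index {infinite} = id

record Alphabet : Set where
  field
    size    : Size
    arity   : Index size → ℕ
    arityPR : Σ (Scheme ⊥ 1) λ s → ∀ i → eval noOracle s (index i ∷ []) ≡ arity i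

  Symbol : Set
  Symbol = Index size

  UniformlyPrimRec : ((i : Symbol) → Vec ℕ (arity i) → ℕ) → Set
  UniformlyPrimRec F =
    Σ (Scheme ⊥ 2) λ s → ∀ i xs → eval noOracle s (index i ∷ code xs ∷ []) ≡ F i xs

record Signature : Set where
  field
    relations  : Alphabet
    operations : Alphabet

  module Rel = Alphabet relations
  module Op  = Alphabet operations

module _ (L : Signature) where
  open Signature L

  record PunctualStructure : Set where
    field
      rel   : (r : Rel.Symbol) → Vec ℕ (Rel.arity r) → Bool
      op    : (o : Op.Symbol) → Vec ℕ (Op.arity o) → ℕ
      relPR : Rel.UniformlyPrimRec (λ r xs → bit (rel r xs))
      opPR  : Op.UniformlyPrimRec op

module _ {L : Signature} where
  open Signature L
  open PunctualStructure

  record Isomorphism (A B : PunctualStructure L) : Set where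
    field
      bijection : ℕ ↔ ℕ

    open Inverse bijection public using (to; from)

    field
      rel-preserved : ∀ r xs → rel A r xs ≡ rel B r (map to xs)
      op-preserved  : ∀ o xs → to (op A o xs) ≡ op B o (map to xs)

  PunctuallyIsomorphic : PunctualStructure L → PunctualStructure L → Set
  PunctuallyIsomorphic A B =
    Σ (Isomorphism A B) λ h → PrimRec₁ (Isomorphism.to h) × PrimRec₁ (Isomorphism.from h)

-- The hypothesis A ≅ B is carried by h.

LowForPunctualIsomorphism : (ℕ → ℕ) → Set
LowForPunctualIsomorphism f =
  ∀ (L : Signature) (A B : PunctualStructure L) (h : Isomorphism A B) →
  (Isomorphism.to h ⊕ Isomorphism.from h) ≤PR f →
  PunctuallyIsomorphic A B

{-# OPTIONS --safe #-}
module Submission where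

open import Defs
open import Axiom.ExcludedMiddle using (ExcludedMiddle)
open import Data.Bool using (Bool; true; false)
open import Data.Empty using (⊥; ⊥-elim)
open import Data.Fin as Fin using (Fin; fromℕ<)
open import Data.Fin.Patterns using (0F; 1F; 2F; 3F)
open import Data.Fin.Properties using (toℕ<n; toℕ-fromℕ<)
open import Data.Nat
open import Data.Nat.Properties
open import Data.Product using (Σ; ∃-syntax; _×_; _,_; proj₁; proj₂)
open import Data.Unit using (⊤; tt)
open import Data.Vec using (Vec; []; _∷_; head; lookup; map; tabulate; tail)
open import Data.Vec.Properties using (map-cong; map-id; tabulate-∘; tabulate∘lookup)
open import Function using (Equivalence; Inverse; _∘_; _⇔_; id; mk↔ₛ′)
open import Level using (0ℓ)
open import Relation.Binary.PropositionalEquality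
open import Relation.Nullary using (¬_; contradiction; no; yes)

-- A PR functional Ψ turns "Ψ^g ⊕-codes an isomorphism A → B" into a closed
-- condition on g: for all k a primitive recursive test of g at k succeeds, so
-- an oracle machine v that searches for a failing test halts on exactly the
-- bad g.  Let f be the characteristic function of a set whose gaps outgrow the
-- settling time of W, so that f ≡T W.  If v halted on every oracle σ0^ω, then
-- G n, a bound on the use of v on σ0^ω for all σ of length n, would be
-- computable; were v to diverge on f, every gap of f starting at n would end
-- before G n, making W computable.  So if Ψ^f codes an isomorphism, then so
-- does Ψ^g for some g = σ0^ω, and as g is primitive recursive, so is Ψ^g.

private variable
  Ω Ω′ : Set
  k m n : ℕ

-- Primitive recursive functionals and their combinators.

Oracle : Set → Set
Oracle Ω = Ω → ℕ → ℕ

-- The scheme does not depend on the oracle, so it can be evaluated at f and at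
-- every finite string alike.
record PR (F : Oracle Ω → Vec ℕ n → ℕ) : Set where
  field
    scheme  : Scheme Ω n
    correct : ∀ φ xs → eval φ scheme xs ≡ F φ xs

record PRs (F : Oracle Ω → Vec ℕ n → Vec ℕ m) : Set where
  field
    schemes : Vec (Scheme Ω n) m
    correct : ∀ φ xs → evals φ schemes xs ≡ F φ xs

open PR
open PRs

private variable
  F F₁ F₂ : Oracle Ω → Vec ℕ n → ℕ
  G G₁ : Oracle Ω → Vec ℕ n → Vec ℕ m

-- `Vec` has no eta rule, so a function built by the combinators and the intended one may agree only
-- after the argument vector is split.
cast : {F F₁ : Oracle Ω → Vec ℕ n → ℕ} → (∀ φ xs → F φ xs ≡ F₁ φ xs) → PR F → PR F₁
cast e f .scheme = f .scheme
cast e f .correct φ xs = trans (f .correct φ xs) (e φ xs)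

casts : {G G₁ : Oracle Ω → Vec ℕ n → Vec ℕ m} → (∀ φ xs → G φ xs ≡ G₁ φ xs) → PRs G → PRs G₁
casts e g .schemes = g .schemes
casts e g .correct φ xs = trans (g .correct φ xs) (e φ xs)

fromScheme : (s : Scheme Ω n) → PR (λ φ → eval φ s)
fromScheme s .scheme = s
fromScheme s .correct φ xs = refl

ε : PRs {Ω} {n} (λ _ _ → [])
ε .schemes = []
ε .correct _ _ = refl

infixr 5 _◂_
infixl 9 _⟨_⟩

_◂_ : PR F → PRs G → PRs (λ φ xs → F φ xs ∷ G φ xs)
(f ◂ g) .schemes = f .scheme ∷ g .schemes
(f ◂ g) .correct φ xs = cong₂ _∷_ (f .correct φ xs) (g .correct φ xs)

_⟨_⟩ : PR F → PRs G → PR (λ φ xs → F φ (G φ xs))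
(f ⟨ g ⟩) .scheme = comp (f .scheme) (g .schemes)
(_⟨_⟩ {F = F} f g) .correct φ xs =
  trans (f .correct φ _) (cong (F φ) (g .correct φ xs))

evals-comp : ∀ (φ : Oracle Ω) (ss : Vec (Scheme Ω m) k) (ts : Vec (Scheme Ω n) m) xs →
             evals φ (map (λ s → comp s ts) ss) xs ≡ evals φ ss (evals φ ts xs)
evals-comp φ []       ts xs = refl
evals-comp φ (s ∷ ss) ts xs = cong (_ ∷_) (evals-comp φ ss ts xs)

_⟪_⟫ : PRs G → PRs G₁ → PRs (λ φ xs → G φ (G₁ φ xs))
(g ⟪ h ⟫) .schemes = map (λ s → comp s (h .schemes)) (g .schemes)
(_⟪_⟫ {G = G} g h) .correct φ xs =
  trans (evals-comp φ (g .schemes) (h .schemes) xs)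
        (trans (g .correct φ _) (cong (G φ) (h .correct φ xs)))

var : (i : Fin n) → PR {Ω} (λ _ xs → lookup xs i)
var i .scheme = proj i
var i .correct _ _ = refl

tabulates : {H : Oracle Ω → Vec ℕ n → Fin m → ℕ} →
            (∀ i → PR (λ φ xs → H φ xs i)) → PRs (λ φ xs → tabulate (H φ xs))
tabulates f .schemes = tabulate (λ i → f i .scheme)
tabulates {m = zero}  f .correct φ xs = refl
tabulates {m = suc m} f .correct φ xs =
  cong₂ _∷_ (f 0F .correct φ xs) (tabulates (f ∘ Fin.suc) .correct φ xs)

vars : (ρ : Fin m → Fin n) → PRs {Ω} (λ _ xs → tabulate (lookup xs ∘ ρ))
vars ρ = tabulates (var ∘ ρ)

drop₁ : PRs {Ω} {suc n} (λ _ xs → tail xs)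
drop₁ = casts (λ { _ (x ∷ xs) → tabulate∘lookup xs }) (vars Fin.suc)

drop₂ : PRs {Ω} {2 + n} (λ _ xs → tail (tail xs))
drop₂ = drop₁ ⟪ drop₁ ⟫

drop₃ : PRs {Ω} {3 + n} (λ _ xs → tail (tail (tail xs)))
drop₃ = drop₂ ⟪ drop₁ ⟫

drop₄ : PRs {Ω} {4 + n} (λ _ xs → tail (tail (tail (tail xs))))
drop₄ = drop₂ ⟪ drop₂ ⟫

-- Functions defined by `rec` match the output of `primRec`, so their schemes need no inductive
-- proof of correctness.
rec : ℕ → (ℕ → ℕ → ℕ) → ℕ → ℕ
rec a f zero    = a
rec a f (suc x) = f x (rec a f x)

primRec : PR F → PR F₁ →
          PR (λ φ xs → rec (F φ (tail xs)) (λ i r → F₁ φ (i ∷ r ∷ tail xs)) (lookup xs 0F))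
primRec f g .scheme = prec (f .scheme) (g .scheme)
primRec {F = F} {F₁ = F₁} f g .correct φ (x ∷ xs) = go x
  where
  go : ∀ x → evalRec φ (f .scheme) (g .scheme) x xs ≡ rec (F φ xs) (λ i r → F₁ φ (i ∷ r ∷ xs)) x
  go zero    = f .correct φ xs
  go (suc x) = trans (g .correct φ _) (cong (λ r → F₁ φ (x ∷ r ∷ xs)) (go x))

num : ∀ a → PR {Ω} {n} (λ _ _ → a)
num zero    = record { scheme = comp zer [] ; correct = λ _ _ → refl }
num (suc a) = record
  { scheme = comp succ (num a .scheme ∷ []) ; correct = λ φ xs → cong suc (num a .correct φ xs) }

infixl 6 _`+_ _`∸_

`suc : PR F → PR (λ φ xs → suc (F φ xs))
`suc f = record { scheme = comp succ (f .scheme ∷ []) ; correct = λ φ xs → cong suc (f .correct φ xs) }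

`pred : PR F → PR (λ φ xs → pred (F φ xs))
`pred f = predPR ⟨ f ◂ ε ⟩
  where
  predPR : PR {Ω} {1} (λ _ xs → pred (lookup xs 0F))
  predPR = cast (λ { _ (zero ∷ []) → refl ; _ (suc _ ∷ []) → refl }) (primRec (num 0) (var 0F))

preds : PRs {Ω} {m} (λ _ xs → map pred xs)
preds = casts (λ _ xs → trans (tabulate-∘ pred (lookup xs)) (cong (map pred) (tabulate∘lookup xs)))
              (tabulates (λ i → `pred (var i)))

_`+_ : PR F → PR F₁ → PR (λ φ xs → F φ xs + F₁ φ xs)
f `+ g = plus ⟨ f ◂ g ◂ ε ⟩
  where
  lemma : ∀ x y → rec y (λ _ r → suc r) x ≡ x + y
  lemma zero    y = refl
  lemma (suc x) y = cong suc (lemma x y)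

  plus : PR {Ω} (λ _ xs → lookup xs 0F + lookup xs 1F)
  plus = cast (λ { _ (x ∷ y ∷ []) → lemma x y }) (primRec (var 0F) (`suc (var 1F)))

_`∸_ : PR F → PR F₁ → PR (λ φ xs → F φ xs ∸ F₁ φ xs)
f `∸ g = monus ⟨ g ◂ f ◂ ε ⟩
  where
  lemma : ∀ y x → rec x (λ _ r → pred r) y ≡ x ∸ y
  lemma zero    x = refl
  lemma (suc y) x = trans (cong pred (lemma y x)) (pred[m∸n]≡m∸[1+n] x y)

  monus : PR {Ω} (λ _ xs → lookup xs 1F ∸ lookup xs 0F)
  monus = cast (λ { _ (y ∷ x ∷ []) → lemma y x }) (primRec (var 0F) (`pred (var 1F)))

ifz : ℕ → ℕ → ℕ → ℕ
ifz zero    a b = a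
ifz (suc _) a b = b

`ifz : PR F → PR F₁ → PR F₂ → PR (λ φ xs → ifz (F φ xs) (F₁ φ xs) (F₂ φ xs))
`ifz f g h = ifzPR ⟨ f ◂ g ◂ h ◂ ε ⟩
  where
  ifzPR : PR {Ω} (λ _ xs → ifz (lookup xs 0F) (lookup xs 1F) (lookup xs 2F))
  ifzPR = cast (λ { _ (zero ∷ _ ∷ _ ∷ []) → refl ; _ (suc _ ∷ _ ∷ _ ∷ []) → refl })
               (primRec (var 0F) (var 3F))

-- Serves as a bounded quantifier: universal for tests that succeed with value 0, existential for
-- tests that succeed with a positive value.
sumBelow : (ℕ → ℕ) → ℕ → ℕ
sumBelow f = rec 0 (λ i r → r + f i)

`sum : PR F → PR (λ φ xs → sumBelow (λ i → F φ (i ∷ tail xs)) (lookup xs 0F))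
`sum f = primRec (num 0) (var 1F `+ f ⟨ var 0F ◂ drop₂ ⟩)

sumBelow≡0 : ∀ f n → sumBelow f n ≡ 0 → ∀ {i} → i < n → f i ≡ 0
sumBelow≡0 f (suc n) e {i} i<1+n with i ≟ n
... | yes refl = m+n≡0⇒n≡0 (sumBelow f n) e
... | no i≢n = sumBelow≡0 f n (m+n≡0⇒m≡0 (sumBelow f n) e) (≤∧≢⇒< (s≤s⁻¹ i<1+n) i≢n)

≡0⇒sumBelow : ∀ f n → (∀ i → i < n → f i ≡ 0) → sumBelow f n ≡ 0
≡0⇒sumBelow f zero    h = refl
≡0⇒sumBelow f (suc n) h =
  cong₂ _+_ (≡0⇒sumBelow f n (λ i i<n → h i (m<n⇒m<1+n i<n))) (h n (n<1+n n))

sumBelow-mono : ∀ f {m n} → m ≤ n → sumBelow f m ≤ sumBelow f n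
sumBelow-mono f {m} {zero}  z≤n = z≤n
sumBelow-mono f {m} {suc n} m≤1+n with m ≟ suc n
... | yes refl = ≤-refl
... | no m≢1+n = ≤-trans (sumBelow-mono f (s≤s⁻¹ (≤∧≢⇒< m≤1+n m≢1+n))) (m≤m+n _ _)

term≤sumBelow : ∀ f n → f n ≤ sumBelow f (suc n)
term≤sumBelow f n = m≤n+m (f n) _

sumBelow>0 : ∀ f n → 0 < sumBelow f n → ∃[ i ] i < n × 0 < f i
sumBelow>0 f (suc n) pos with f n in eq
... | suc _ = n , n<1+n n , subst (0 <_) (sym eq) (s≤s z≤n)
... | zero with sumBelow>0 f n (subst (0 <_) (+-identityʳ _) pos)
...   | i , i<n , fi = i , m<n⇒m<1+n i<n , fi

-- Finite oracles

-- `half` counts the odd numbers below its argument, which gives the quotient by 2 rounded down.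
odd half : ℕ → ℕ
odd  = rec 0 (λ _ r → 1 ∸ r)
half = rec 0 (λ i r → r + odd i)

-- c codes the string of its binary digits, least significant first, continued by zeros.
look : ℕ → ℕ → ℕ
look c x = odd (rec c (λ _ r → half r) x)

`look : PR {Ω} {2} (λ _ v → look (lookup v 0F) (lookup v 1F))
`look = oddPR ⟨ primRec (var 0F) (halfPR ⟨ var 1F ◂ ε ⟩) ⟨ var 1F ◂ var 0F ◂ ε ⟩ ◂ ε ⟩
  where
  oddPR : PR (λ _ v → odd (lookup v 0F))
  oddPR = primRec (num 0) (num 1 `∸ var 1F)

  halfPR : PR (λ _ v → half (lookup v 0F))
  halfPR = primRec (num 0) (var 1F `+ oddPR ⟨ var 0F ◂ ε ⟩)

odd-double : ∀ k → odd (k + k) ≡ 0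
odd-double zero = refl
odd-double (suc k) rewrite +-suc k k | odd-double k = refl

half-double : ∀ k → half (k + k) ≡ k
half-double zero = refl
half-double (suc k) rewrite +-suc k k | half-double k | odd-double k =
  trans (+-comm (k + 0) 1) (cong suc (+-identityʳ k))

half-bit+double : ∀ {b} → b ≤ 1 → ∀ k → half (b + (k + k)) ≡ k
half-bit+double z≤n       k = half-double k
half-bit+double (s≤s z≤n) k rewrite half-double k | odd-double k = +-identityʳ k

odd-bit+double : ∀ {b} → b ≤ 1 → ∀ k → odd (b + (k + k)) ≡ b
odd-bit+double z≤n       k = odd-double k
odd-bit+double (s≤s z≤n) k rewrite odd-double k = refl

-- The recursion in `look` peels off the outermost `half`; induction on strings needs the innermost
-- one peeled off.
look-suc : ∀ c x → look c (suc x) ≡ look (half c) x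
look-suc c x = cong odd (lemma x)
  where
  lemma : ∀ x → rec c (λ _ r → half r) (suc x) ≡ rec (half c) (λ _ r → half r) x
  lemma zero    = refl
  lemma (suc x) = cong half (lemma x)

look-zero : ∀ x → look 0 x ≡ 0
look-zero zero    = refl
look-zero (suc x) = trans (look-suc 0 x) (look-zero x)

bits : (ℕ → ℕ) → ℕ → ℕ
bits f zero    = 0
bits f (suc n) = f 0 + (bits (f ∘ suc) n + bits (f ∘ suc) n)

look-bits-< : ∀ f → (∀ x → f x ≤ 1) → ∀ n {x} → x < n → look (bits f n) x ≡ f x
look-bits-< f f≤1 (suc n) {zero}  _ = odd-bit+double (f≤1 0) (bits (f ∘ suc) n)
look-bits-< f f≤1 (suc n) {suc x} (s≤s x<n) = begin
  look (bits f (suc n)) (suc x)    ≡⟨ look-suc (bits f (suc n)) x ⟩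
  look (half (bits f (suc n))) x   ≡⟨ cong (λ c → look c x) (half-bit+double (f≤1 0) (bits (f ∘ suc) n)) ⟩
  look (bits (f ∘ suc) n) x        ≡⟨ look-bits-< (f ∘ suc) (f≤1 ∘ suc) n x<n ⟩
  f (suc x)                        ∎
  where open ≡-Reasoning

look-bits-≥ : ∀ f → (∀ x → f x ≤ 1) → ∀ n {x} → n ≤ x → look (bits f n) x ≡ 0
look-bits-≥ f f≤1 zero    {x} _ = look-zero x
look-bits-≥ f f≤1 (suc n) {suc x} (s≤s n≤x) = begin
  look (bits f (suc n)) (suc x)    ≡⟨ look-suc (bits f (suc n)) x ⟩
  look (half (bits f (suc n))) x   ≡⟨ cong (λ c → look c x) (half-bit+double (f≤1 0) (bits (f ∘ suc) n)) ⟩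
  look (bits (f ∘ suc) n) x        ≡⟨ look-bits-≥ (f ∘ suc) (f≤1 ∘ suc) n n≤x ⟩
  0                                ∎
  where open ≡-Reasoning

pow2 : ℕ → ℕ
pow2 = rec 1 (λ _ r → r + r)

`pow2 : PR {Ω} {1} (λ _ v → pow2 (lookup v 0F))
`pow2 = primRec (num 1) (var 1F `+ var 1F)

-- Makes a quantifier over the codes below `pow2 n` cover the prefix of `f` of length `n`.
bits<pow2 : ∀ f → (∀ x → f x ≤ 1) → ∀ n → bits f n < pow2 n
bits<pow2 f f≤1 zero    = s≤s z≤n
bits<pow2 f f≤1 (suc n) = begin
  suc (f 0 + (b + b))  ≤⟨ s≤s (+-monoˡ-≤ (b + b) (f≤1 0)) ⟩
  suc (suc (b + b))    ≡⟨ cong suc (+-suc b b) ⟨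
  suc b + suc b        ≤⟨ +-mono-≤ b<p b<p ⟩
  pow2 n + pow2 n      ∎
  where
  open ≤-Reasoning
  b = bits (f ∘ suc) n
  b<p = bits<pow2 (f ∘ suc) (f≤1 ∘ suc) n

-- Bounded interpretation of programs

undefs : Vec ℕ m → ℕ
undefs []       = 0
undefs (y ∷ ys) = ifz y 1 0 + undefs ys

-- The states are 0 (a value of q was undefined), 1 (still searching) and 2 + y
-- (least zero y found); like run below, q returns 0 for undefined and 1 + y for y.
search : (ℕ → ℕ) → ℕ → ℕ
search q = rec 1 (λ b r → ifz r 0 (ifz (pred r) (ifz (q b) 0 (ifz (pred (q b)) (2 + b) 1)) r))

-- s bounds both the minimisations and the oracle queries, so a converging run
-- has use at most s.
mutual
  run : Program Ω n → ℕ → (ℕ → ℕ) → Vec ℕ n → ℕ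
  run zer         s u xs       = 1
  run succ        s u xs       = 2 + lookup xs 0F
  run (proj i)    s u xs       = suc (lookup xs i)
  run (comp p qs) s u xs       = ifz (undefs (runs qs s u xs)) (run p s u (map pred (runs qs s u xs))) 0
  run (prec p q)  s u xs =
    rec (run p s u (tail xs)) (λ i r → ifz r 0 (run q s u (i ∷ pred r ∷ tail xs))) (lookup xs 0F)
  run (mini p)    s u xs       = pred (search (λ y → run p s u (y ∷ xs)) s)
  run (orac _)    s u xs       = ifz (suc (lookup xs 0F) ∸ s) (suc (u (lookup xs 0F))) 0

  runs : Vec (Program Ω n) m → ℕ → (ℕ → ℕ) → Vec ℕ n → Vec ℕ m
  runs []       s u xs = []
  runs (q ∷ qs) s u xs = run q s u xs ∷ runs qs s u xs

`undefs : PR {Ω} {m} (λ _ v → undefs v)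
`undefs {m = zero}  = cast (λ { _ [] → refl }) (num 0)
`undefs {m = suc m} = cast (λ { _ (y ∷ ys) → refl }) (`ifz (var 0F) (num 1) (num 0) `+ `undefs ⟨ drop₁ ⟩)

mutual
  -- The vector holds the bound, the code of the oracle, then the arguments of `p`. Queries of `p`
  -- are answered from the code, so the interpreter asks no oracle itself and `Ω′` is arbitrary.
  `run : (p : Program Ω n) →
         PR {Ω′} (λ _ v → run p (lookup v 0F) (look (lookup v 1F)) (tail (tail v)))
  `run zer         = num 1
  `run succ        = cast (λ { _ (_ ∷ _ ∷ _ ∷ []) → refl }) (`suc (`suc (var 2F)))
  `run (proj i)    = cast (λ { _ (_ ∷ _ ∷ _) → refl }) (`suc (var (Fin.suc (Fin.suc i))))
  `run (comp p qs) =
    `ifz (`undefs ⟨ `runs qs ⟩) (`run p ⟨ var 0F ◂ var 1F ◂ preds ⟪ `runs qs ⟫ ⟩) (num 0)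
  `run (prec p q)  = cast (λ { _ (_ ∷ _ ∷ _ ∷ _) → refl })
    (primRec (`run p)
             (`ifz (var 1F) (num 0) (`run q ⟨ var 2F ◂ var 3F ◂ var 0F ◂ `pred (var 1F) ◂ drop₄ ⟩))
      -- The recursion argument moves ahead of the bound and the oracle code.
      ⟨ var 2F ◂ var 0F ◂ var 1F ◂ drop₃ ⟩)
  `run (mini p)    = cast (λ { _ (_ ∷ _ ∷ _) → refl }) (`pred
    (primRec (num 1)
       (`ifz (var 1F) (num 0) (`ifz (`pred (var 1F))
          (`ifz q (num 0) (`ifz (`pred q) (`suc (`suc (var 0F))) (num 1))) (var 1F)))
      -- The bound is duplicated: it is the length of the search and also the bound passed on to
      -- `p`.
      ⟨ var 0F ◂ var 0F ◂ drop₁ ⟩))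
    where q = `run p ⟨ var 2F ◂ var 3F ◂ var 0F ◂ drop₄ ⟩
  `run (orac o)    = cast (λ { _ (_ ∷ _ ∷ _ ∷ []) → refl })
    (`ifz (`suc (var 2F) `∸ var 0F) (`suc (`look ⟨ var 1F ◂ var 2F ◂ ε ⟩)) (num 0))

  `runs : (qs : Vec (Program Ω n) m) →
          PRs {Ω′} (λ _ v → runs qs (lookup v 0F) (look (lookup v 1F)) (tail (tail v)))
  `runs []       = ε
  `runs (q ∷ qs) = `run q ◂ `runs qs

module _ {q : ℕ → ℕ} where

  -- In the coding of `run`, `2 + w` is a defined positive value and 1 is the value 0. State 1
  -- survives a round only through a positive value.
  search≡1⇒ : ∀ b → search q b ≡ 1 → ∀ {z} → z < b → ∃[ w ] q z ≡ 2 + w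
  search≡1⇒ (suc b) e {z} z<1+b with search q b in r
  ... | suc zero with q b in qb
  ...   | suc (suc w) with z ≟ b
  ...     | yes refl = w , qb
  ...     | no z≢b = search≡1⇒ b r (≤∧≢⇒< (s≤s⁻¹ z<1+b) z≢b)

  search≡2+⇒ : ∀ b {y} → search q b ≡ 2 + y → q y ≡ 1 × (∀ z → z < y → ∃[ w ] q z ≡ 2 + w)
  search≡2+⇒ (suc b) e with search q b in r
  ... | suc (suc _) = search≡2+⇒ b (trans r e)
  ... | suc zero with q b in qb
  ...   | suc zero with e
  ...     | refl = qb , λ z → search≡1⇒ b r

  ⇒search≡1 : ∀ b → (∀ z → z < b → ∃[ w ] q z ≡ 2 + w) → search q b ≡ 1
  ⇒search≡1 zero    h = refl
  ⇒search≡1 (suc b) h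
    rewrite ⇒search≡1 b (λ z z<b → h z (m<n⇒m<1+n z<b)) | proj₂ (h b (n<1+n b)) = refl

  ⇒search≡2+ : ∀ {y} b → q y ≡ 1 → (∀ z → z < y → ∃[ w ] q z ≡ 2 + w) →
               y < b → search q b ≡ 2 + y
  ⇒search≡2+ {y} (suc b) qy h y<1+b with y ≟ b
  ... | yes refl rewrite ⇒search≡1 y h | qy = refl
  ... | no y≢b rewrite ⇒search≡2+ b qy h (≤∧≢⇒< (s≤s⁻¹ y<1+b) y≢b) = refl

undefs≡0 : (ys : Vec ℕ m) → undefs ys ≡ 0 → map suc (map pred ys) ≡ ys
undefs≡0 []           e = refl
undefs≡0 (suc y ∷ ys) e = cong (suc y ∷_) (undefs≡0 ys e)

undefs-suc : (ys : Vec ℕ m) → undefs (map suc ys) ≡ 0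
undefs-suc []       = refl
undefs-suc (y ∷ ys) = undefs-suc ys

map-pred-suc : (ys : Vec ℕ m) → map pred (map suc ys) ≡ ys
map-pred-suc []       = refl
map-pred-suc (y ∷ ys) = cong (y ∷_) (map-pred-suc ys)

module _ {φ : Oracle Ω} {u : ℕ → ℕ} {s : ℕ} (agree : ∀ o x → x < s → φ o x ≡ u x) where
  mutual
    -- The use principle: a query at or beyond `s` makes the run undefined, so agreement of the
    -- oracles below `s` is enough.
    run-sound : (p : Program Ω n) (xs : Vec ℕ n) {y : ℕ} → run p s u xs ≡ suc y → Eval φ p xs y
    run-sound zer      []       refl = e-zer
    run-sound succ     (x ∷ []) refl = e-succ
    run-sound (proj i) xs       refl = e-proj
    run-sound (comp p qs) xs e with undefs (runs qs s u xs) in d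
    ... | zero = e-comp (runs-sound qs xs (undefs≡0 _ d)) (run-sound p _ e)
    run-sound (prec p q) (x ∷ xs) e = go x e
      where
      go : ∀ x {y} → run (prec p q) s u (x ∷ xs) ≡ suc y → Eval φ (prec p q) (x ∷ xs) y
      go zero    e = e-prec₀ (run-sound p xs e)
      go (suc x) e with run (prec p q) s u (x ∷ xs) in r
      ... | suc y = e-precₛ (go x r) (run-sound q _ e)
    run-sound (mini p) xs e with search (λ y → run p s u (y ∷ xs)) s in r
    run-sound (mini p) xs refl | suc (suc y) with search≡2+⇒ s r
    ... | found , below = e-mini (run-sound p _ found) λ z z<y →
          proj₁ (below z z<y) , run-sound p _ (proj₂ (below z z<y))
    run-sound (orac o) (x ∷ []) e with suc x ∸ s in d
    run-sound (orac o) (x ∷ []) refl | zero =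
      subst (Eval φ (orac o) _) (agree o x (m∸n≡0⇒m≤n d)) e-orac

    runs-sound : (qs : Vec (Program Ω n) m) (xs : Vec ℕ n) {ys : Vec ℕ m} →
                 map suc ys ≡ runs qs s u xs → Evals φ qs xs ys
    runs-sound []       xs {[]}     e = []
    runs-sound (q ∷ qs) xs {y ∷ ys} e =
      run-sound q xs (sym (cong head e)) ∷ runs-sound qs xs (cong tail e)

-- Asking for all large bounds lets finitely many subruns share the maximum of their bounds, without
-- a proof that `run` is monotone in `s`.
Eventually : (ℕ → Set) → Set
Eventually P = ∃[ b ] ∀ s → b ≤ s → P s

always : {P : ℕ → Set} → (∀ s → P s) → Eventually P
always h = 0 , λ s _ → h s

eventually₂ : {P Q R : ℕ → Set} → (∀ s → P s → Q s → R s) →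
              Eventually P → Eventually Q → Eventually R
eventually₂ f (a , p) (b , q) =
  a ⊔ b , λ s le → f s (p s (m⊔n≤o⇒m≤o a b le)) (q s (m⊔n≤o⇒n≤o a b le))

eventually-all : {P : ℕ → ℕ → Set} → ∀ n → (∀ i → i < n → Eventually (P i)) →
                 Eventually (λ s → ∀ i → i < n → P i s)
eventually-all zero    h = always (λ _ _ ())
eventually-all {P} (suc n) h =
  eventually₂ split (h n (n<1+n n)) (eventually-all n (λ i i<n → h i (m<n⇒m<1+n i<n)))
  where
  split : ∀ s → P n s → (∀ i → i < n → P i s) → ∀ i → i < suc n → P i s
  split s last rest i i<1+n with i ≟ n
  ... | yes refl = last
  ... | no i≢n = rest i (≤∧≢⇒< (s≤s⁻¹ i<1+n) i≢n)

module _ {φ : Oracle Ω} {u : ℕ → ℕ} (agree : ∀ o x → φ o x ≡ u x) where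
  mutual
    run-complete : {p : Program Ω n} {xs : Vec ℕ n} {y : ℕ} → Eval φ p xs y →
                   Eventually (λ s → run p s u xs ≡ suc y)
    run-complete e-zer         = always (λ _ → refl)
    run-complete e-succ        = always (λ _ → refl)
    run-complete e-proj        = always (λ _ → refl)
    run-complete (e-comp {p = p} {qs} {xs} {ys} {z} es e) = eventually₂ both (runs-complete es) (run-complete e)
      where
      both : ∀ s → runs qs s u xs ≡ map suc ys → run p s u ys ≡ suc z →
             run (comp p qs) s u xs ≡ suc z
      both s rs r rewrite rs | undefs-suc ys | map-pred-suc ys = r
    run-complete (e-prec₀ e) = run-complete e
    run-complete (e-precₛ {p = p} {q} {x} {xs} {y} {z} e e′) = eventually₂ both (run-complete e) (run-complete e′)
      where
      both : ∀ s → run (prec p q) s u (x ∷ xs) ≡ suc y → run q s u (x ∷ y ∷ xs) ≡ suc z →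
             run (prec p q) s u (suc x ∷ xs) ≡ suc z
      both s r r′ rewrite r = r′
    run-complete (e-mini {p = p} {xs} {y} e es) =
      eventually₂ (λ s (y<s , r) below → cong pred
                    (⇒search≡2+ s r (λ z z<y → proj₁ (es z z<y) , below z z<y _) y<s))
        (eventually₂ (λ _ → _,_) (suc y , λ _ → λ y<s → y<s) (run-complete e))
        (eventually-all y below-eventually)
      where
      below-eventually : ∀ z → (z<y : z < y) →
              Eventually (λ s → ∀ z<y → run p s u (z ∷ xs) ≡ 2 + proj₁ (es z z<y))
      below-eventually z z<y with run-complete (proj₂ (es z z<y))
      ... | b , h = b , λ s le z<y′ →
              -- The witness given by `es` may depend on the proof of `z < y`, so two such proofs
              -- are identified.
              trans (h s le) (cong (λ lt → 2 + proj₁ (es z lt)) (<-irrelevant z<y z<y′))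
    run-complete (e-orac {o} {x}) = suc x , λ s x<s → both s x<s
      where
      both : ∀ s → x < s → run (orac {Ω} o) s u (x ∷ []) ≡ suc (φ o x)
      both s x<s rewrite m≤n⇒m∸n≡0 x<s = cong suc (sym (agree o x))

    runs-complete : {qs : Vec (Program Ω n) m} {xs : Vec ℕ n} {ys : Vec ℕ m} → Evals φ qs xs ys →
                    Eventually (λ s → runs qs s u xs ≡ map suc ys)
    runs-complete []       = always (λ _ → refl)
    runs-complete (e ∷ es) = eventually₂ (λ _ → cong₂ _∷_) (run-complete e) (runs-complete es)

-- Turing reducibility

-- Unfolds to `_≤T_` for one oracle and to `Computable` for none, so both are handled at once.
RecursiveIn : Oracle Ω → (ℕ → ℕ) → Set
RecursiveIn {Ω} φ f = Σ (Program Ω 1) λ p → ∀ x → Eval φ p (x ∷ []) (f x)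

mutual
  toProgram : Scheme Ω n → Program Ω n
  toProgram zer         = zer
  toProgram succ        = succ
  toProgram (proj i)    = proj i
  toProgram (comp s ss) = comp (toProgram s) (toPrograms ss)
  toProgram (prec s t)  = prec (toProgram s) (toProgram t)
  toProgram (orac o)    = orac o

  toPrograms : Vec (Scheme Ω n) m → Vec (Program Ω n) m
  toPrograms []       = []
  toPrograms (s ∷ ss) = toProgram s ∷ toPrograms ss

module _ (φ : Oracle Ω) where
  mutual
    Eval-toProgram : (s : Scheme Ω n) (xs : Vec ℕ n) → Eval φ (toProgram s) xs (eval φ s xs)
    Eval-toProgram zer         []       = e-zer
    Eval-toProgram succ        (x ∷ []) = e-succ
    Eval-toProgram (proj i)    xs       = e-proj
    Eval-toProgram (comp s ss) xs       = e-comp (Evals-toPrograms ss xs) (Eval-toProgram s _)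
    Eval-toProgram (prec s t)  (x ∷ xs) = go x
      where
      go : ∀ x → Eval φ (prec (toProgram s) (toProgram t)) (x ∷ xs) (evalRec φ s t x xs)
      go zero    = e-prec₀ (Eval-toProgram s xs)
      go (suc x) = e-precₛ (go x) (Eval-toProgram t _)
    Eval-toProgram (orac o)    (x ∷ []) = e-orac

    Evals-toPrograms : (ss : Vec (Scheme Ω n) m) (xs : Vec ℕ n) →
                       Evals φ (toPrograms ss) xs (evals φ ss xs)
    Evals-toPrograms []       xs = []
    Evals-toPrograms (s ∷ ss) xs = Eval-toProgram s xs ∷ Evals-toPrograms ss xs

  PR⇒RecursiveIn : {F : Oracle Ω → Vec ℕ 1 → ℕ} {f : ℕ → ℕ} →
                   PR F → (∀ x → F φ (x ∷ []) ≡ f x) → RecursiveIn φ f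
  PR⇒RecursiveIn F e = toProgram (F .scheme) , λ x →
    subst (Eval φ _ _) (trans (F .correct φ _) (e x)) (Eval-toProgram (F .scheme) (x ∷ []))

module _ (σ : Ω → Program Ω′ 1) where
  mutual
    substP : Program Ω n → Program Ω′ n
    substP zer         = zer
    substP succ        = succ
    substP (proj i)    = proj i
    substP (comp p qs) = comp (substP p) (substPs qs)
    substP (prec p q)  = prec (substP p) (substP q)
    substP (mini p)    = mini (substP p)
    substP (orac o)    = σ o

    substPs : Vec (Program Ω n) m → Vec (Program Ω′ n) m
    substPs []       = []
    substPs (p ∷ ps) = substP p ∷ substPs ps

  module _ {φ : Oracle Ω} {φ′ : Oracle Ω′} (Eval-σ : ∀ o x → Eval φ′ (σ o) (x ∷ []) (φ o x)) where
    mutual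
      Eval-substP : {p : Program Ω n} {xs : Vec ℕ n} {y : ℕ} → Eval φ p xs y → Eval φ′ (substP p) xs y
      Eval-substP e-zer         = e-zer
      Eval-substP e-succ        = e-succ
      Eval-substP e-proj        = e-proj
      Eval-substP (e-comp es e) = e-comp (Evals-substPs es) (Eval-substP e)
      Eval-substP (e-prec₀ e)   = e-prec₀ (Eval-substP e)
      Eval-substP (e-precₛ e f) = e-precₛ (Eval-substP e) (Eval-substP f)
      Eval-substP (e-mini e es) =
        e-mini (Eval-substP e) λ z z<y → proj₁ (es z z<y) , Eval-substP (proj₂ (es z z<y))
      Eval-substP e-orac        = Eval-σ _ _

      Evals-substPs : {ps : Vec (Program Ω n) m} {xs : Vec ℕ n} {ys : Vec ℕ m} →
                      Evals φ ps xs ys → Evals φ′ (substPs ps) xs ys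
      Evals-substPs []       = []
      Evals-substPs (e ∷ es) = Eval-substP e ∷ Evals-substPs es

≤T-RecursiveIn : {φ : Oracle Ω} {f g : ℕ → ℕ} → f ≤T g → RecursiveIn φ g → RecursiveIn φ f
≤T-RecursiveIn (p , p-f) (q , q-g) =
  substP (λ _ → q) p , λ x → Eval-substP (λ _ → q) (λ _ → q-g) (p-f x)

least : (T : ℕ → ℕ) → ∀ y → T y ≡ 0 → ∃[ μ ] T μ ≡ 0 × (∀ z → z < μ → ∃[ w ] T z ≡ suc w)
least T zero    e = 0 , e , λ _ ()
least T (suc y) e with T 0 in e₀
... | zero = 0 , e₀ , λ _ ()
... | suc w with least (T ∘ suc) y e
...   | μ , Tμ , below = suc μ , Tμ , λ where
          zero    _          → w , e₀
          (suc z) (s≤s z<μ) → below z z<μ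

Eval-mini : (φ : Oracle Ω) {F : Oracle Ω → Vec ℕ (suc n) → ℕ} (T : PR F) →
            ∀ xs y → F φ (y ∷ xs) ≡ 0 →
            ∃[ μ ] Eval φ (mini (toProgram (T .scheme))) xs μ × F φ (μ ∷ xs) ≡ 0 ×
                   (∀ z → z < μ → F φ (z ∷ xs) ≢ 0)
Eval-mini φ {F} T xs y e with least (λ y → F φ (y ∷ xs)) y e
... | μ , Fμ , below =
  μ , e-mini (evaluates Fμ) (λ z z<μ → proj₁ (below z z<μ) , evaluates (proj₂ (below z z<μ))) ,
  Fμ , λ z z<μ Fz → contradiction (trans (sym (proj₂ (below z z<μ))) Fz) λ ()
  where
  evaluates : ∀ {y w} → F φ (y ∷ xs) ≡ w → Eval φ (toProgram (T .scheme)) (y ∷ xs) w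
  evaluates e = subst (Eval φ _ _) (trans (T .correct φ _) e) (Eval-toProgram φ (T .scheme) _)

-- `total` only ensures that the search ends; `μ` is what the program finds, hence recursive in `φ`.
-- Minimality is recorded for `G-mono`.
minimise : (φ : Oracle Ω) {F : Oracle Ω → Vec ℕ 2 → ℕ} → PR F →
           (∀ x → ∃[ y ] F φ (y ∷ x ∷ []) ≡ 0) →
           ∃[ μ ] RecursiveIn φ μ × (∀ x → F φ (μ x ∷ x ∷ []) ≡ 0) ×
                  (∀ x z → z < μ x → F φ (z ∷ x ∷ []) ≢ 0)
minimise φ T total = (λ x → proj₁ (μ x)) , (_ , λ x → proj₁ (proj₂ (μ x))) ,
  (λ x → proj₁ (proj₂ (proj₂ (μ x)))) , λ x → proj₂ (proj₂ (proj₂ (μ x)))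
  where
  μ : ∀ x → _
  μ x = Eval-mini φ T (x ∷ []) (proj₁ (total x)) (proj₂ (total x))

`query : PR F → PR (λ φ xs → φ tt (F φ xs))
`query f = queryPR ⟨ f ◂ ε ⟩
  where
  queryPR : PR {⊤} (λ φ xs → φ tt (lookup xs 0F))
  queryPR = record { scheme = orac tt ; correct = λ { φ (x ∷ []) → refl } }

-- The generic function

module Construction {W : ℕ → Bool} (enumerator : Program ⊥ 1)
  (enumerates : ∀ x → (W x ≡ true) ⇔ (∃[ y ] Eval noOracle enumerator (x ∷ []) y)) where

  w : ℕ → ℕ
  w = bit ∘ W

  -- Summing over the bounds makes the approximation monotone in `b`. The enumerator has no oracle
  -- to ask, so `look 0` is a dummy.
  enumerated : ℕ → ℕ → ℕ
  enumerated b x = sumBelow (λ s → run enumerator s (look 0) (x ∷ [])) b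

  `enumerated : PR {Ω} {2} (λ _ v → enumerated (lookup v 0F) (lookup v 1F))
  `enumerated = cast (λ { _ (b ∷ x ∷ []) → refl })
                     (`sum (`run enumerator ⟨ var 0F ◂ num 0 ◂ var 1F ◂ ε ⟩))

  enumerated⇒∈ : ∀ b x → 0 < enumerated b x → w x ≡ 1
  enumerated⇒∈ b x pos with sumBelow>0 (λ s → run enumerator s (look 0) (x ∷ [])) b pos
  ... | s , _ , _ with run enumerator s (look 0) (x ∷ []) in r
  ...   | suc y = cong bit (Equivalence.from (enumerates x) (y , run-sound (λ ()) enumerator _ r))

  enumerated-eventually : ∀ x → Eventually (λ b → w x ≤ enumerated b x)
  enumerated-eventually x with W x in e
  ... | false = always (λ _ → z≤n)
  ... | true with run-complete {u = look 0} (λ ()) (proj₂ (Equivalence.to (enumerates x) e))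
  ...   | s , h = suc s , λ b s<b → ≤-trans (subst (1 ≤_) (sym (h s ≤-refl)) (s≤s z≤n))
            (≤-trans (term≤sumBelow (λ s → run enumerator s (look 0) (x ∷ [])) s) (sumBelow-mono _ s<b))

  -- Membership of `x` is decided by inspecting stage `B x`, as an element that has not appeared by
  -- then never will.
  settled⇒RecursiveIn : {φ : Oracle Ω} {B : ℕ → ℕ} → RecursiveIn φ B →
                        (∀ x → w x ≤ enumerated (B x) x) → RecursiveIn φ w
  settled⇒RecursiveIn {B = B} B-rec settled = ≤T-RecursiveIn w≤B B-rec
    where
    -- `1 ∸ (1 ∸ a)` is the sign of `a`: it turns a positive count into the bit 1.
    value : ∀ x → 1 ∸ (1 ∸ enumerated (B x) x) ≡ w x
    value x with enumerated (B x) x in e | settled x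
    ... | zero  | le = sym (n≤0⇒n≡0 le)
    ... | suc a | _ rewrite 0∸n≡0 a = sym (enumerated⇒∈ (B x) x (subst (0 <_) (sym e) (s≤s z≤n)))

    w≤B : w ≤T B
    w≤B = PR⇒RecursiveIn (oracle B)
      (num 1 `∸ (num 1 `∸ `enumerated ⟨ `query (var 0F) ◂ var 0F ◂ ε ⟩)) value

  modulus : ∃[ p ] p ≤T w × (∀ n x → x ≤ n → w x ≤ enumerated (p n) x)
  modulus with minimise (oracle w)
    -- The candidate stage is `var 0F` of the outer vector; the sum ranges over `x ≤ n`, whence the
    -- `suc`, and vanishes once every such element of `W` has appeared.
    (`sum (`query (var 0F) `∸ `enumerated ⟨ var 1F ◂ var 0F ◂ ε ⟩) ⟨ `suc (var 1F) ◂ var 0F ◂ ε ⟩)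
    (λ n → let b , h = eventually-all (suc n) (λ x _ → enumerated-eventually x)
           in b , ≡0⇒sumBelow _ (suc n) (λ x x≤n → m≤n⇒m∸n≡0 (h b ≤-refl x x≤n)))
  ... | p , p≤w , zeros , _ =
    p , p≤w , λ n x x≤n → m∸n≡0⇒m≤n (sumBelow≡0 _ (suc n) (zeros n) (s≤s x≤n))

  module Marking {p : ℕ → ℕ} (p≤Tw : p ≤T w)
    (p-settles : ∀ n x → x ≤ n → w x ≤ enumerated (p n) x) where

    -- next x is the least marked point ≥ x; a marked point x is followed by x + p x + 1.
    next : ℕ → ℕ
    next = rec 0 (λ x r → ifz (r ∸ x) (suc (x + p x)) r)

    -- The characteristic function of the set of marked points, those with `next x ≡ x`.
    f : ℕ → ℕ
    f x = 1 ∸ (next x ∸ x)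

    f≤1 : ∀ x → f x ≤ 1
    f≤1 x = m∸n≤m 1 (next x ∸ x)

    f≤Tw : f ≤T w
    f≤Tw = ≤T-RecursiveIn
      (PR⇒RecursiveIn (oracle p)
        (num 1 `∸ (primRec (num 0) (`ifz (var 1F `∸ var 0F) (`suc (var 0F `+ `query (var 0F))) (var 1F)) `∸ var 0F))
        (λ _ → refl))
      p≤Tw

    x≤next : ∀ x → x ≤ next x
    x≤next zero    = z≤n
    x≤next (suc x) with next x ∸ x in e
    ... | zero  = s≤s (m≤m+n x (p x))
    ... | suc d = ≰⇒> λ le → contradiction (trans (sym e) (m≤n⇒m∸n≡0 le)) λ ()

    next-suc : ∀ {x} → x < next x → next (suc x) ≡ next x
    next-suc {x} lt with next x ∸ x in e
    ... | zero  = contradiction lt (≤⇒≯ (m∸n≡0⇒m≤n e))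
    ... | suc _ = refl

    next-marked : ∀ {x} → next x ≡ x → next (suc x) ≡ suc (x + p x)
    next-marked {x} e rewrite e | n∸n≡0 x = refl

    next-constant : ∀ {x} y → x ≤ y → y ≤ next x → next y ≡ next x
    next-constant {x} y x≤y y≤ with x ≟ y
    ... | yes refl = refl
    next-constant {x} zero    x≤y y≤ | no x≢y = contradiction (n≤0⇒n≡0 x≤y) x≢y
    next-constant {x} (suc y) x≤y y≤ | no x≢y = trans (next-suc (subst (y <_) (sym ih) y≤)) ih
      where
      ih : next y ≡ next x
      ih = next-constant y (s≤s⁻¹ (≤∧≢⇒< x≤y x≢y)) (<⇒≤ y≤)

    next-next : ∀ x → next (next x) ≡ next x
    next-next x = next-constant (next x) (x≤next x) ≤-refl

    f-gap : ∀ {x y} → x ≤ y → y < next x → f y ≡ 0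
    f-gap {x} {y} x≤y y< =
      m≤n⇒m∸n≡0 (m<n⇒0<n∸m (subst (y <_) (sym (next-constant y x≤y (<⇒≤ y<))) y<))

    f-marked : ∀ x → 1 ∸ f x ≡ 0 → next x ≡ x
    f-marked x e with next x ∸ x in d
    ... | zero  = ≤-antisym (m∸n≡0⇒m≤n d) (x≤next x)
    ... | suc a rewrite 0∸n≡0 a = contradiction e λ ()

    -- The gap after the marked point `y` is longer than `p y`, a stage by which `W` is settled up
    -- to `y`.
    settled-after : ∀ {x y b} → x ≤ y → next y ≡ y → next (suc y) ≤ b → w x ≤ enumerated b x
    settled-after {x} {y} {b} x≤y marked le = begin
      w x                ≤⟨ p-settles y x x≤y ⟩
      enumerated (p y) x ≤⟨ sumBelow-mono _ p≤b ⟩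
      enumerated b x     ∎
      where
      open ≤-Reasoning
      p≤b : p y ≤ b
      p≤b = ≤-trans (m≤n+m (p y) (suc y)) (subst (_≤ b) (next-marked marked) le)

    -- With oracle `f` one finds a marked point at or after `x` and then a further one; the latter
    -- bounds a stage at which `x` is settled. The minimised test vanishes when the candidate is at
    -- least `x` and marked.
    w≤Tf : w ≤T f
    w≤Tf with minimise (oracle f) ((var 1F `∸ var 0F) `+ (num 1 `∸ `query (var 0F)))
      (λ x → next x , cong₂ _+_ (m≤n⇒m∸n≡0 (x≤next x)) (cong (λ a → 1 ∸ (1 ∸ a)) (trans (cong (_∸ next x) (next-next x)) (n∸n≡0 (next x)))))
    ... | N , N≤f , zeros , _ =
      settled⇒RecursiveIn
        (≤T-RecursiveIn (PR⇒RecursiveIn (oracle N) {f = λ x → N (suc (N x))} (`query (`suc (`query (var 0F)))) (λ _ → refl)) N≤f)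
        (λ x → settled-after (x≤N x) (marked x) (next≤N (suc (N x))))
      where
      x≤N : ∀ x → x ≤ N x
      x≤N x = m∸n≡0⇒m≤n (m+n≡0⇒m≡0 (x ∸ N x) (zeros x))

      marked : ∀ x → next (N x) ≡ N x
      marked x = f-marked (N x) (m+n≡0⇒n≡0 (x ∸ N x) (zeros x))

      next≤N : ∀ x → next x ≤ N x
      next≤N x = ≮⇒≥ λ N<next → contradiction (trans (sym (marked x)) (next-constant (N x) (x≤N x) (<⇒≤ N<next))) (<⇒≢ N<next)

    pow2-mono : ∀ {m n} → m ≤ n → pow2 m ≤ pow2 n
    pow2-mono {zero}  {zero}  z≤n = ≤-refl
    pow2-mono {zero}  {suc n} z≤n = ≤-trans (pow2-mono {zero} {n} z≤n) (m≤m+n _ _)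
    pow2-mono (s≤s m≤n) = +-mono-≤ (pow2-mono m≤n) (pow2-mono m≤n)

    -- Nonzero iff the bounded run of v on the oracle coded by c converges for some bound below m.
    hits : Program ⊤ 0 → ℕ → ℕ → ℕ
    hits v m c = sumBelow (λ s → run v s (look c) []) m

    -- `G n` is the least `m` such that `hits v m c` is positive for all `c < pow2 n`. It exists
    -- because `v` halts on each of these finitely many oracles.
    halts-generically : (v : Program ⊤ 0) → (∀ c → ∃[ y ] Eval (oracle (look c)) v [] y) →
                        ¬ (∃[ y ] Eval (oracle f) v [] y) → Computable w
    halts-generically v halts diverges with minimise noOracle
      (`sum (num 1 `∸ `sum (`run v ⟨ var 0F ◂ var 1F ◂ ε ⟩) ⟨ var 1F ◂ var 0F ◂ ε ⟩) ⟨ `pow2 ⟨ var 1F ◂ ε ⟩ ◂ var 0F ◂ ε ⟩)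
      (λ n → let m , h = eventually-all (pow2 n) (λ c _ → hits-eventually c)
             in m , ≡0⇒sumBelow _ (pow2 n) (λ c c< → h m ≤-refl c c<))
      where
      hits-eventually : ∀ c → Eventually (λ m → 1 ∸ hits v m c ≡ 0)
      hits-eventually c with run-complete {u = look c} (λ _ _ → refl) (proj₂ (halts c))
      ... | s , h = suc s , λ m s<m → m≤n⇒m∸n≡0 (≤-trans (subst (1 ≤_) (sym (h s ≤-refl)) (s≤s z≤n))
              (≤-trans (term≤sumBelow (λ s → run v s (look c) []) s) (sumBelow-mono _ s<m)))
    ... | G , G-rec , zeros , minimal =
      settled⇒RecursiveIn
        (≤T-RecursiveIn (PR⇒RecursiveIn (oracle G) {f = λ x → G (G x)} (`query (`query (var 0F))) (λ _ → refl)) G-rec)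
        (λ x → settled-after (x≤next x) (next-next x)
                 -- `G x` exceeds the marked point `next x`, so applying the monotone `G` again
                 -- exceeds the marked point after that.
                 (≤-trans (<⇒≤ (next<G (suc (next x)))) (G-mono (next<G x))))
      where
      -- Since `f` vanishes from `x` up to `next x`, it agrees below `next x` with its prefix of
      -- length `x` padded by zeros. A run with use at most `next x` would therefore converge on `f`
      -- too.
      use : ∀ x s {y} → run v s (look (bits f x)) [] ≡ suc y → next x < s
      use x s r = ≰⇒> λ s≤next → diverges (_ , run-sound (λ _ z z<s → agree z (<-≤-trans z<s s≤next)) v [] r)
        where
        agree : ∀ z → z < next x → f z ≡ look (bits f x) z
        agree z z<next with z <? x
        ... | yes z<x = sym (look-bits-< f f≤1 x z<x)
        ... | no z≮x  = trans (f-gap (≮⇒≥ z≮x) z<next) (sym (look-bits-≥ f f≤1 x (≮⇒≥ z≮x)))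

      next<G : ∀ x → next x < G x
      next<G x with sumBelow>0 (λ s → run v s (look (bits f x)) []) (G x)
                      (m∸n≡0⇒m≤n (sumBelow≡0 _ (pow2 x) (zeros x) (bits<pow2 f f≤1 x)))
      ... | s , s<G , pos with run v s (look (bits f x)) [] in r
      ...   | suc _ = <-trans (use x s r) s<G

      -- `G n` passes the test that defines `G m`, which concerns fewer codes, and `G m` is the
      -- least number to do so.
      G-mono : ∀ {m n} → m ≤ n → G m ≤ G n
      G-mono {m} {n} m≤n = ≮⇒≥ λ Gn<Gm → minimal m (G n) Gn<Gm
        (n≤0⇒n≡0 (≤-trans (sumBelow-mono (λ c → 1 ∸ hits v (G n) c) (pow2-mono m≤n)) (≤-reflexive (zeros n))))

-- Determinism of, and substitution into, primitive recursive schemes.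

module _ (φ : Oracle Ω) where
  mutual
    Eval-toProgram⇒≡ : (s : Scheme Ω n) {xs : Vec ℕ n} {y : ℕ} →
                        Eval φ (toProgram s) xs y → y ≡ eval φ s xs
    Eval-toProgram⇒≡ zer         e-zer  = refl
    Eval-toProgram⇒≡ succ        e-succ = refl
    Eval-toProgram⇒≡ (proj i)    e-proj = refl
    Eval-toProgram⇒≡ (comp s ss) (e-comp es e) with refl ← Evals-toPrograms⇒≡ ss es =
      Eval-toProgram⇒≡ s e
    Eval-toProgram⇒≡ (prec s t)  (e-prec₀ e) = Eval-toProgram⇒≡ s e
    Eval-toProgram⇒≡ (prec s t)  (e-precₛ e e′) with refl ← Eval-toProgram⇒≡ (prec s t) e =
      Eval-toProgram⇒≡ t e′
    Eval-toProgram⇒≡ (orac o)    e-orac = refl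

    Evals-toPrograms⇒≡ : (ss : Vec (Scheme Ω n) m) {xs : Vec ℕ n} {ys : Vec ℕ m} →
                          Evals φ (toPrograms ss) xs ys → ys ≡ evals φ ss xs
    Evals-toPrograms⇒≡ []       []       = refl
    Evals-toPrograms⇒≡ (s ∷ ss) (e ∷ es) = cong₂ _∷_ (Eval-toProgram⇒≡ s e) (Evals-toPrograms⇒≡ ss es)

module _ (σ : Ω → Scheme Ω′ 1) where
  mutual
    substS : Scheme Ω n → Scheme Ω′ n
    substS zer         = zer
    substS succ        = succ
    substS (proj i)    = proj i
    substS (comp s ss) = comp (substS s) (substSs ss)
    substS (prec s t)  = prec (substS s) (substS t)
    substS (orac o)    = σ o

    substSs : Vec (Scheme Ω n) m → Vec (Scheme Ω′ n) m
    substSs []       = []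
    substSs (s ∷ ss) = substS s ∷ substSs ss

  module _ {φ : Oracle Ω} {φ′ : Oracle Ω′} (eval-σ : ∀ o x → eval φ′ (σ o) (x ∷ []) ≡ φ o x) where
    mutual
      eval-substS : (s : Scheme Ω n) (xs : Vec ℕ n) → eval φ′ (substS s) xs ≡ eval φ s xs
      eval-substS zer         []       = refl
      eval-substS succ        (x ∷ []) = refl
      eval-substS (proj i)    xs       = refl
      eval-substS (comp s ss) xs       =
        trans (eval-substS s _) (cong (eval φ s) (evals-substSs ss xs))
      eval-substS (prec s t)  (x ∷ xs) = go x
        where
        go : ∀ x → evalRec φ′ (substS s) (substS t) x xs ≡ evalRec φ s t x xs
        go zero    = eval-substS s xs
        go (suc x) = trans (eval-substS t _) (cong (λ r → eval φ t (x ∷ r ∷ xs)) (go x))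
      eval-substS (orac o)    (x ∷ []) = eval-σ o x

      evals-substSs : (ss : Vec (Scheme Ω n) m) (xs : Vec ℕ n) → evals φ′ (substSs ss) xs ≡ evals φ ss xs
      evals-substSs []       xs = refl
      evals-substSs (s ∷ ss) xs = cong₂ _∷_ (eval-substS s xs) (evals-substSs ss xs)

fromPlain : (s : Scheme ⊥ n) → PR {Ω} (λ _ → eval noOracle s)
fromPlain s .scheme = substS ⊥-elim s
fromPlain s .correct _ = eval-substS ⊥-elim (λ ()) s

-- Tuples and isomorphisms

`triangle : PR F → PR (λ φ xs → triangle (F φ xs))
`triangle f = trianglePR ⟨ f ◂ ε ⟩
  where
  trianglePR : PR {Ω} {1} (λ _ v → triangle (lookup v 0F))
  trianglePR = cast (λ { _ (x ∷ []) → lemma x }) (primRec (num 0) (`suc (var 0F) `+ var 1F))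
    where
    lemma : ∀ x → rec 0 (λ i r → suc i + r) x ≡ triangle x
    lemma zero    = refl
    lemma (suc x) = cong (suc x +_) (lemma x)

-- The largest `r` with `triangle r ≤ z`, that is, the antidiagonal of the Cantor pairing on which
-- `z` lies.
root : ℕ → ℕ
root = rec 0 (λ z r → ifz (triangle (suc r) ∸ suc z) (suc r) r)

root-triangle : ∀ n y → y ≤ n → root (triangle n + y) ≡ n
root-triangle zero zero _ = refl
-- The first point of a diagonal: its predecessor is `triangle n + n`, the last point of the
-- diagonal before.
root-triangle (suc n) zero _
  rewrite +-identityʳ (n + triangle n) | +-comm n (triangle n) | root-triangle n n ≤-refl
        | +-comm (triangle n) n | n∸n≡0 (n + triangle n) = refl
root-triangle n (suc y) y<n
  rewrite +-suc (triangle n) y | root-triangle n y (<⇒≤ y<n)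
  with n + triangle n ∸ (triangle n + y) in d
... | suc _ = refl
... | zero  = contradiction (m∸n≡0⇒m≤n d)
  (<⇒≱ (subst (_< n + triangle n) (+-comm y _) (+-monoˡ-< (triangle n) y<n)))

unpair₂ unpair₁ : ℕ → ℕ
unpair₂ z = z ∸ triangle (root z)
unpair₁ z = root z ∸ unpair₂ z

unpair₂-pair : ∀ x y → unpair₂ (pair x y) ≡ y
unpair₂-pair x y rewrite root-triangle (x + y) y (m≤n+m y x) = m+n∸m≡n (triangle (x + y)) y

unpair₁-pair : ∀ x y → unpair₁ (pair x y) ≡ x
unpair₁-pair x y rewrite unpair₂-pair x y | root-triangle (x + y) y (m≤n+m y x) = m+n∸n≡m x y

`root : PR {Ω} {1} (λ _ v → root (lookup v 0F))
`root = primRec (num 0) (`ifz (`triangle (`suc (var 1F)) `∸ `suc (var 0F)) (`suc (var 1F)) (var 1F))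

`unpair₂ `unpair₁ : PR {Ω} {1} (λ _ v → _)
`unpair₂ = cast {F₁ = λ _ v → unpair₂ (lookup v 0F)} (λ _ _ → refl) (var 0F `∸ `triangle `root)
`unpair₁ = cast {F₁ = λ _ v → unpair₁ (lookup v 0F)} (λ _ _ → refl) (`root `∸ `unpair₂)

`pair : PR F → PR F₁ → PR (λ φ xs → pair (F φ xs) (F₁ φ xs))
`pair f g = `triangle (f `+ g) `+ g

decode : ∀ n → ℕ → Vec ℕ n
decode zero    z = []
decode (suc n) z = unpair₁ z ∷ decode n (unpair₂ z)

decode-code : (xs : Vec ℕ n) → decode n (code xs) ≡ xs
decode-code []       = refl
decode-code (x ∷ xs) rewrite unpair₁-pair x (code xs) | unpair₂-pair x (code xs) =
  cong (x ∷_) (decode-code xs)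

mapCode : (ℕ → ℕ) → ℕ → ℕ → ℕ
mapCode t n z = code (map t (decode n z))

dropCode : ℕ → ℕ → ℕ
dropCode z = rec z (λ _ → unpair₂)

-- The arity varies with the symbol, so the length must be a numerical argument. The recursion
-- builds the code from the last entry to the first: after `j` rounds it covers the last `j`
-- entries.
`mapCode : {F : Oracle Ω → Vec ℕ 1 → ℕ} → PR F →
           PR {n = 2} (λ φ v → mapCode (λ x → F φ (x ∷ [])) (lookup v 0F) (lookup v 1F))
`mapCode {F = F} t = cast (λ { φ (n ∷ z ∷ []) → lemma′ (λ x → F φ (x ∷ [])) n z })
  (primRec (num 0)
     (`pair (t ⟨ `unpair₁ ⟨ `dropCode ⟨ var 2F `∸ `suc (var 0F) ◂ var 3F ◂ ε ⟩ ◂ ε ⟩ ◂ ε ⟩) (var 1F))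
   ⟨ var 0F ◂ var 0F ◂ var 1F ◂ ε ⟩)
  where
  `dropCode : PR {Ω} {2} (λ _ v → dropCode (lookup v 1F) (lookup v 0F))
  `dropCode = cast (λ { _ (_ ∷ _ ∷ []) → refl }) (primRec (var 0F) (`unpair₂ ⟨ var 1F ◂ ε ⟩))

  lemma : ∀ t n z j → j ≤ n →
          rec 0 (λ j r → pair (t (unpair₁ (dropCode z (n ∸ suc j)))) r) j ≡ mapCode t j (dropCode z (n ∸ j))
  lemma t n z zero    _   = refl
  lemma t n z (suc j) j<n = cong (pair (t (unpair₁ (dropCode z (n ∸ suc j))))) (trans (lemma t n z j (<⇒≤ j<n))
    (cong (λ i → mapCode t j (dropCode z i)) (+-∸-assoc 1 j<n)))

  lemma′ : ∀ t n z → rec 0 (λ j r → pair (t (unpair₁ (dropCode z (n ∸ suc j)))) r) n ≡ mapCode t n z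
  lemma′ t n z = trans (lemma t n z n ≤-refl) (cong (λ i → mapCode t n (dropCode z i)) (n∸n≡0 n))

distance : ℕ → ℕ → ℕ
distance x y = (x ∸ y) + (y ∸ x)

distance≡0⇒≡ : ∀ x y → distance x y ≡ 0 → x ≡ y
distance≡0⇒≡ x y e = ≤-antisym (m∸n≡0⇒m≤n (m+n≡0⇒m≡0 (x ∸ y) e)) (m∸n≡0⇒m≤n (m+n≡0⇒n≡0 (x ∸ y) e))

≡⇒distance≡0 : ∀ {x y} → x ≡ y → distance x y ≡ 0
≡⇒distance≡0 {x} refl = cong₂ _+_ (n∸n≡0 x) (n∸n≡0 x)

`distance : PR F → PR F₁ → PR (λ φ xs → distance (F φ xs) (F₁ φ xs))
`distance f g = (f `∸ g) `+ (g `∸ f)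

-- Closed conditions on an oracle, and the one saying that a functional yields an isomorphism.

record Refutable (P : Oracle Ω → Set) : Set where
  field
    refutes   : Oracle Ω → Vec ℕ 1 → ℕ
    refutesPR : PR refutes
    sound     : ∀ φ → (∀ k → refutes φ (k ∷ []) ≡ 0) → P φ
    complete  : ∀ φ → P φ → ∀ k → refutes φ (k ∷ []) ≡ 0

open Refutable

_∧_ : {P Q : Oracle Ω → Set} → Refutable P → Refutable Q → Refutable (λ φ → P φ × Q φ)
(a ∧ b) .refutes φ k  = a .refutes φ k + b .refutes φ k
(a ∧ b) .refutesPR    = a .refutesPR `+ b .refutesPR
(a ∧ b) .sound φ h    =
  a .sound φ (λ k → m+n≡0⇒m≡0 (a .refutes φ (k ∷ [])) (h k)) ,
  b .sound φ (λ k → m+n≡0⇒n≡0 (a .refutes φ (k ∷ [])) (h k))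
(a ∧ b) .complete φ (p , q) k = cong₂ _+_ (a .complete φ p k) (b .complete φ q k)

pointwise-≡ : {F F₁ : Oracle Ω → Vec ℕ 1 → ℕ} → PR F → PR F₁ →
              Refutable (λ φ → ∀ x → F φ (x ∷ []) ≡ F₁ φ (x ∷ []))
pointwise-≡ {F = F} {F₁} f g .refutes φ v  = distance (F φ v) (F₁ φ v)
pointwise-≡ f g .refutesPR      = `distance f g
pointwise-≡ f g .sound φ h x    = distance≡0⇒≡ _ _ (h x)
pointwise-≡ f g .complete φ h x = ≡⇒distance≡0 (h x)

invalid : Size → ℕ → ℕ
invalid (finite N) r = suc r ∸ N
invalid infinite   r = 0

`invalid : ∀ σ → PR {Ω} {1} (λ _ v → invalid σ (lookup v 0F))
`invalid (finite N) = `suc (var 0F) `∸ num N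
`invalid infinite   = num 0

invalid-index : ∀ {σ} (i : Index σ) → invalid σ (index i) ≡ 0
invalid-index {finite N} i = m≤n⇒m∸n≡0 (toℕ<n i)
invalid-index {infinite} i = refl

valid⇒index : ∀ σ r → invalid σ r ≡ 0 → ∃[ i ] index {σ} i ≡ r
valid⇒index (finite N) r e = fromℕ< (m∸n≡0⇒m≤n e) , toℕ-fromℕ< (m∸n≡0⇒m≤n e)
valid⇒index infinite   r e = r , refl

module _ (𝒜 : Alphabet) where
  open Alphabet 𝒜

  module _ {f g : (i : Symbol) → Vec ℕ (arity i) → ℕ}
           (fPR : UniformlyPrimRec f) (gPR : UniformlyPrimRec g)
           {P T : Oracle Ω → Vec ℕ 1 → ℕ} (post : PR P) (t : PR T) where

    private
      arityOf : ℕ → ℕ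
      arityOf r = eval noOracle (proj₁ arityPR) (r ∷ [])

      -- `P` acts on the value in the first structure: it is the identity for relations and the
      -- isomorphism for operations, so one test serves both.
      check : Oracle Ω → ℕ → ℕ → ℕ
      check φ r z = distance
        (P φ (eval noOracle (proj₁ fPR) (r ∷ mapCode id (arityOf r) z ∷ []) ∷ []))
        (eval noOracle (proj₁ gPR) (r ∷ mapCode (λ x → T φ (x ∷ [])) (arityOf r) z ∷ []))

      check-index : ∀ φ i z → let xs = decode (arity i) z in
        check φ (index i) z ≡ distance (P φ (f i xs ∷ [])) (g i (map (λ x → T φ (x ∷ [])) xs))
      check-index φ i z
        rewrite proj₂ arityPR i | map-id (decode (arity i) z)
              | proj₂ fPR i (decode (arity i) z)
              | proj₂ gPR i (map (λ x → T φ (x ∷ [])) (decode (arity i) z)) = refl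

      `check : PR {n = 2} (λ φ v → check φ (lookup v 0F) (lookup v 1F))
      `check = `distance
        (post ⟨ fromPlain (proj₁ fPR) ⟨ var 0F ◂ `mapCode (var 0F) ⟨ ar ◂ var 1F ◂ ε ⟩ ◂ ε ⟩ ◂ ε ⟩)
        (fromPlain (proj₁ gPR) ⟨ var 0F ◂ `mapCode t ⟨ ar ◂ var 1F ◂ ε ⟩ ◂ ε ⟩)
        where ar = fromPlain (proj₁ arityPR) ⟨ var 0F ◂ ε ⟩

    -- Indices of no symbol are skipped, and z is replaced by the code mapCode id of
    -- a tuple of the right length: on junk the schemes for f and g are unrelated.
    preserved : Refutable (λ φ → ∀ i xs → P φ (f i xs ∷ []) ≡ g i (map (λ x → T φ (x ∷ [])) xs))
    preserved .refutes φ v =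
      ifz (invalid size (unpair₁ (lookup v 0F))) (check φ (unpair₁ (lookup v 0F)) (unpair₂ (lookup v 0F))) 0
    preserved .refutesPR =
      `ifz (`invalid size ⟨ `unpair₁ ◂ ε ⟩) (`check ⟨ `unpair₁ ◂ `unpair₂ ◂ ε ⟩) (num 0)
    preserved .sound φ h i xs
      with e ← h (pair (index i) (code xs))
      rewrite unpair₁-pair (index i) (code xs) | unpair₂-pair (index i) (code xs)
            | invalid-index i | check-index φ i (code xs) | decode-code xs = distance≡0⇒≡ _ _ e
    preserved .complete φ h k with invalid size (unpair₁ k) in e
    ... | suc _ = refl
    ... | zero with valid⇒index size (unpair₁ k) e
    ...   | i , i≡ rewrite sym i≡ = trans (check-index φ i (unpair₂ k)) (≡⇒distance≡0 (h i _))

module _ {L : Signature} (A B : PunctualStructure L) where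
  open PunctualStructure

  -- All clauses are equations between numbers and can thus be tested by `distance`. `t` and `u` are
  -- bare functions because `Ψ` need not compute an isomorphism from every oracle.
  record IsIsomorphism (t u : ℕ → ℕ) : Set where
    field
      left-inverse  : ∀ x → t (u x) ≡ x
      right-inverse : ∀ x → u (t x) ≡ x
      relations     : ∀ r xs → bit (A .rel r xs) ≡ bit (B .rel r (map t xs))
      operations    : ∀ o xs → t (A .op o xs) ≡ B .op o (map t xs)

  isIsomorphism⇒Isomorphism : ∀ {t u} → IsIsomorphism t u → Isomorphism A B
  isIsomorphism⇒Isomorphism {t} {u} iso = record
    { bijection     = mk↔ₛ′ t u left-inverse right-inverse
    ; rel-preserved = λ r xs → bit-injective (relations r xs)
    ; op-preserved  = operations
    }
    where
    open IsIsomorphism iso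
    bit-injective : ∀ {a b} → bit a ≡ bit b → a ≡ b
    bit-injective {false} {false} _ = refl
    bit-injective {true}  {true}  _ = refl

  module _ (Ψ : Scheme ⊤ 1) where

    forward backward : Oracle ⊤ → ℕ → ℕ
    forward  φ x = eval φ Ψ (2 * x ∷ [])
    backward φ x = eval φ Ψ (suc (2 * x) ∷ [])

    `forward : PR {n = 1} (λ φ v → forward φ (lookup v 0F))
    -- `x + (x + 0)` is the unfolding of `2 * x`.
    `forward = fromScheme Ψ ⟨ (var 0F `+ (var 0F `+ num 0)) ◂ ε ⟩

    `backward : PR {n = 1} (λ φ v → backward φ (lookup v 0F))
    `backward = fromScheme Ψ ⟨ `suc (var 0F `+ (var 0F `+ num 0)) ◂ ε ⟩

    isIsomorphism-refutable : Refutable (λ φ → IsIsomorphism (forward φ) (backward φ))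
    isIsomorphism-refutable = record
      { refutes   = conditions .refutes
      ; refutesPR = conditions .refutesPR
      ; sound     = λ φ h → let l , r , rels , ops = conditions .sound φ h in record
          { left-inverse = l ; right-inverse = r ; relations = rels ; operations = ops }
      ; complete  = λ φ iso → let open IsIsomorphism iso in
          conditions .complete φ (left-inverse , right-inverse , relations , operations)
      }
      where
      conditions : Refutable _
      conditions = pointwise-≡ (`forward ⟨ `backward ◂ ε ⟩) (var 0F)
                 ∧ (pointwise-≡ (`backward ⟨ `forward ◂ ε ⟩) (var 0F)
                 ∧ (preserved (Signature.relations L) (A .relPR) (B .relPR) (var 0F) `forward
                 ∧ preserved (Signature.operations L) (A .opPR) (B .opPR) `forward `forward))

  Isomorphism⇒isIsomorphism : (h : Isomorphism A B) {t u : ℕ → ℕ} →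
    (∀ x → t x ≡ Isomorphism.to h x) → (∀ x → u x ≡ Isomorphism.from h x) → IsIsomorphism t u
  Isomorphism⇒isIsomorphism h {t} {u} t≗ u≗ = record
    { left-inverse  = λ x → trans (cong t (u≗ x)) (trans (t≗ _) (Inverse.strictlyInverseˡ bijection x))
    ; right-inverse = λ x → trans (cong u (t≗ x)) (trans (u≗ _) (Inverse.strictlyInverseʳ bijection x))
    ; relations     = λ r xs → cong bit (trans (rel-preserved r xs) (cong (B .rel r) (sym (map-cong t≗ xs))))
    ; operations    = λ o xs → trans (t≗ _) (trans (op-preserved o xs) (cong (B .op o) (sym (map-cong t≗ xs))))
    }
    where open Isomorphism h

-- The oracle `look c` is itself primitive recursive, so a scheme for it can replace the queries.
specialise : {F : Oracle ⊤ → Vec ℕ 1 → ℕ} → PR F → ∀ c → PrimRec₁ (λ x → F (oracle (look c)) (x ∷ []))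
specialise f c = substS (λ _ → lookc .scheme) (f .scheme) , λ x →
  trans (eval-substS _ {oracle (look c)} (λ _ y → lookc .correct noOracle (y ∷ [])) (f .scheme) (x ∷ []))
        (f .correct _ _)
  where
  lookc : PR {⊥} {1} (λ _ v → look c (lookup v 0F))
  lookc = `look ⟨ num c ◂ var 0F ◂ ε ⟩

-- Genericity and lowness.

Halts : Program ⊤ 0 → (ℕ → ℕ) → Set
Halts v g = ∃[ y ] Eval (oracle g) v [] y

Generic : (ℕ → ℕ) → Set
Generic f = ∀ v → (∀ c → Halts v (look c)) → ¬ ¬ Halts v f

-- If no `look c` satisfied `P`, the search for a failing test would halt on every `look c` while
-- diverging on `f`, against genericity.
generic⇒reflects : ExcludedMiddle 0ℓ → {f : ℕ → ℕ} → Generic f →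
                   {P : Oracle ⊤ → Set} → Refutable P → P (oracle f) → ∃[ c ] P (oracle (look c))
generic⇒reflects em {f} generic {P} test Pf with em {P = ∃[ c ] P (oracle (look c))}
... | yes found = found
... | no none   = ⊥-elim (generic refuter halts-everywhere diverges)
  where
  passes : PR {n = 1} (λ φ v → 1 ∸ test .refutes φ v)
  -- Zero where the test fails, so that minimisation looks for a failure.
  passes = num 1 `∸ test .refutesPR

  refuter : Program ⊤ 0
  refuter = mini (toProgram (passes .scheme))

  halts-everywhere : ∀ c → Halts refuter (look c)
  halts-everywhere c with em {P = ∃[ k ] 1 ∸ test .refutes (oracle (look c)) (k ∷ []) ≡ 0}
  ... | yes (k , e) = let μ , halts , _ = Eval-mini (oracle (look c)) passes [] k e in μ , halts
  ... | no never    = contradiction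
    (c , test .sound _ λ k → n<1⇒n≡0 (≰⇒> λ 1≤ → never (k , m≤n⇒m∸n≡0 1≤))) none

  diverges : ¬ Halts refuter f
  diverges (k , e-mini e _) = contradiction
    (trans (Eval-toProgram⇒≡ (oracle f) (passes .scheme) e)
      (trans (passes .correct (oracle f) (k ∷ [])) (cong (1 ∸_) (test .complete (oracle f) Pf k))))
    λ ()

-- The punctual isomorphism need not be `h`: it is what `Ψ` computes from some `look c`.
generic⇒low : ExcludedMiddle 0ℓ → {f : ℕ → ℕ} → Generic f → LowForPunctualIsomorphism f
generic⇒low em generic L A B h (Ψ , Ψ-h) =
  let c , iso = generic⇒reflects em generic (isIsomorphism-refutable A B Ψ) Ψ-iso
  in isIsomorphism⇒Isomorphism A B iso , specialise (`forward A B Ψ) c , specialise (`backward A B Ψ) c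
  where
  open Isomorphism h using (to; from)

  Ψ-iso = Isomorphism⇒isIsomorphism A B h
    (λ x → trans (Ψ-h (2 * x)) (⊕-even to from x))
    (λ x → trans (Ψ-h (suc (2 * x))) (⊕-odd to from x))

theorem4p1 : ExcludedMiddle 0ℓ →
    (d : ℕ → ℕ) → HasCEDegree d → ¬ Computable d →
    Σ (ℕ → ℕ) λ f → f ≡T d × LowForPunctualIsomorphism f
theorem4p1 em d (W , (enumerator , enumerates) , w≤d , d≤w) d-incomputable =
  f , (≤T-RecursiveIn f≤Tw w≤d , ≤T-RecursiveIn d≤w w≤Tf) ,
  generic⇒low em λ v halts diverges →
    -- A machine violating genericity would make `w`, and with it `d`, computable.
    d-incomputable (≤T-RecursiveIn d≤w (halts-generically v halts diverges))
  where
  open Construction {W} enumerator enumerates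
  open Marking (proj₁ (proj₂ modulus)) (proj₂ (proj₂ modulus))
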